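{- Let $\Sigma$ be any set of leapfrog implications (over a signature $\mathcal{R}$). Then the spi-logic $\mathsf{SPi}+\Sigma$ is complex, and hence complete.
   Context: Fix a non-empty set $\mathcal{R}$ (the signature). Sp-formulas are built from propositional variables (from a countably infinite set) and the constant $\top$ using $\wedge$ and unary diamonds $\Diamond_R$, $R\in\mathcal{R}$; an sp-implication is an expression $\sigma\to\tau$ with $\sigma,\tau$ sp-formulas. A SLO (meet-semilattice with monotone operators) is an algebra $\mathfrak{A}=(A,\wedge,\top,\Diamond_R)_{R\in\mathcal{R}}$ such that $(A,\wedge,\top)$ is a meet-semilattice with top element $\top$ and each $\Diamond_R$ is monotone w.r.t. $a\le b\iff a\wedge b=a$. $\mathfrak{A}$ validates $\sigma\to\tau$ if $\sigma[\mathfrak a]\le\tau[\mathfrak a]$ for every valuation $\mathfrak a$ of the variables in $A$. A frame is $\mathfrak{F}=(W,R^{\mathfrak F})_{R\in\mathcal R}$ with $W\neq\emptyset$ and binary relations $R^{\mathfrak F}$; sp-formulas are evaluated in Kripke models over $\mathfrak F$ as usual ($\Diamond_R\varphi$ is true at $w$ iff $\varphi$ is true at some $v$ with $(w,v)\in R^{\mathfrak F}$); $\mathfrak F$ validates $\sigma\to\tau$ if in every model over $\mathfrak F$, at every point, $\sigma$ true implies $\tau$ true. For a set $\Sigma$ of sp-implications: $\Sigma\models_{\mathsf{Kr}}\iota$ iff $\iota$ is valid in every frame validating $\Sigma$; $\Sigma\models_{\mathsf{SLO}}\iota$ iff $\iota$ is valid in every SLO validating $\Sigma$. The spi-logic $\mathsf{SPi}+\Sigma$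 is the set of sp-implications $\iota$ with $\Sigma\models_{\mathsf{SLO}}\iota$ (equivalently, derivable from substitution instances of $\Sigma$ and of $p\to p$, $p\to\top$, $p\wedge q\to q\wedge p$, $p\wedge q\to p$ by the rules: from $\sigma\to\tau,\tau\to\rho$ infer $\sigma\to\rho$; from $\sigma\to\tau,\sigma\to\rho$ infer $\sigma\to\tau\wedge\rho$; from $\sigma\to\tau$ infer $\Diamond_R\sigma\to\Diamond_R\tau$). It is complete if $\Sigma\models_{\mathsf{Kr}}\iota\iff\Sigma\models_{\mathsf{SLO}}\iota$ for every sp-implication $\iota$. For a frame $\mathfrak F$, $\mathfrak F^\star=(2^W,\cap,W,\Diamond_R^+)_{R}$ where $\Diamond_R^+X=\{w\mid \exists v\in X\,(w,v)\in R^{\mathfrak F}\}$. A spi-logic $L$ is complex if every SLO validating $L$ is embeddable (by an injective map preserving $\wedge,\top$ and all $\Diamond_R$) into $\mathfrak F^\star$ for some frame $\mathfrak F$ validating $L$. A profile is $\pi=(\mathfrak G,S,u,v)$ where $\mathfrak G=(\Delta,R^{\mathfrak G})_{R\in\mathcal R}$ is a finite rooted frame, $u,v\in\Delta$, $S\in\mathcal R$ and $(u,v)\notin S^{\mathfrak G}$; with $\Delta=\{x_0,\dots,x_n\}$ it represents the first-order sentence $\Phi_\pi=\forall x_0\dots x_n\big(\bigwedge_{(x_i,x_j)\in R^{\mathfrak G},R\in\mathcal R}R(x_i,x_j)\to S(u,v)\big)$. An sp-implication $\iota$ is a Horn-implication with profile $\pi$ if, for every frame $\mathfrak F$, $\mathfrak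 F$ validates $\iota$ iff $\mathfrak F\models\Phi_\pi$. A profile is a tree-profile if $(\Delta,\bigcup_R R^{\mathfrak G})$ is a finite directed tree and the relations $R^{\mathfrak G}$ are pairwise disjoint; it is rooted if $u$ is the root of this tree; a rooted tree-profile $(\mathfrak G,S,u,v)$ is leapfrog if there is no $w$ with $(u,w)\in S^{\mathfrak G}$. A leapfrog implication is a Horn-implication of the form $\varrho\to\Diamond_S p$ ($p$ a variable) having a leapfrog profile of the form $(\mathfrak G,S,u,v)$. -}

module Defs where

open import Algebra.Core using (Op₁)
open import Algebra.Lattice.Bundles using (BoundedMeetSemilattice)
open import Data.Fin.Base using (Fin)
open import Data.Nat.Base using (ℕ)
open import Data.Product.Base using (∃; ∃-syntax; _×_; _,_; proj₁; proj₂)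
open import Data.Unit.Polymorphic using (⊤)
open import Function.Bundles using (_↔_; _⇔_)
open import Level using (Level; suc; _⊔_)
open import Relation.Binary.Construct.Closure.ReflexiveTransitive using (Star)
open import Relation.Binary.Core using (Rel)
open import Relation.Binary.PropositionalEquality.Core using (_≡_; _≢_)
open import Relation.Nullary.Negation.Core using (¬_)
open import Relation.Unary using (Pred; _∈_; _∩_; _≐_)
open import Relation.Unary.Algebra using (∩-isIdempotentCommutativeMonoid)
open import Relation.Unary.Polymorphic using (U)

private
  variable
    c c₁ c₂ ℓ ℓ₁ ℓ₂ s : Level

infixr 7 _∧̇_
infix  5 _⟶_

data Formula {ℓ} (𝓡 : Set ℓ) : Set ℓ where
  var  : ℕ → Formula 𝓡
  ⊤̇    : Formula 𝓡
  _∧̇_  : Formula 𝓡 → Formula 𝓡 → Formula 𝓡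
  ◇̇    : 𝓡 → Formula 𝓡 → Formula 𝓡

record Implication {ℓ} (𝓡 : Set ℓ) : Set ℓ where
  constructor _⟶_
  field
    premise    : Formula 𝓡
    conclusion : Formula 𝓡

-- Algebras carry a setoid equality _≈_; subsets of a frame, for instance, are
-- compared extensionally.  Monotonicity makes each ◇ R respect _≈_.

record SLO {r} (𝓡 : Set r) c ℓ : Set (r ⊔ suc (c ⊔ ℓ)) where
  field
    boundedMeetSemilattice : BoundedMeetSemilattice c ℓ

  open BoundedMeetSemilattice boundedMeetSemilattice public
    renaming (⊤ to top)

  infix 4 _≤_
  _≤_ : Rel Carrier ℓ
  a ≤ b = (a ∧ b) ≈ a

  field
    ◇      : 𝓡 → Op₁ Carrier
    ◇-mono : ∀ R {a b} → a ≤ b → ◇ R a ≤ ◇ R b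

module _ {r} {𝓡 : Set r} where

  module _ (𝔄 : SLO 𝓡 c ℓ) where
    open SLO 𝔄

    value : (ℕ → Carrier) → Formula 𝓡 → Carrier
    value 𝔞 (var p)  = 𝔞 p
    value 𝔞 ⊤̇        = top
    value 𝔞 (φ ∧̇ ψ)  = value 𝔞 φ ∧ value 𝔞 ψ
    value 𝔞 (◇̇ R φ)  = ◇ R (value 𝔞 φ)

    _⊨ᴬ_ : Implication 𝓡 → Set (c ⊔ ℓ)
    _⊨ᴬ_ (σ ⟶ τ) = ∀ (𝔞 : ℕ → Carrier) → value 𝔞 σ ≤ value 𝔞 τ

    ValidatesᴬAll : Pred (Implication 𝓡) s → Set (r ⊔ c ⊔ ℓ ⊔ s)
    ValidatesᴬAll Σ = ∀ ι → ι ∈ Σ → _⊨ᴬ_ ι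

  record IsEmbedding (𝔄 : SLO 𝓡 c₁ ℓ₁) (𝔅 : SLO 𝓡 c₂ ℓ₂)
                     (f : SLO.Carrier 𝔄 → SLO.Carrier 𝔅)
                     : Set (r ⊔ c₁ ⊔ ℓ₁ ⊔ ℓ₂) where
    private
      module A = SLO 𝔄
      module B = SLO 𝔅
    field
      cong      : ∀ {a b} → a A.≈ b → f a B.≈ f b
      injective : ∀ {a b} → f a B.≈ f b → a A.≈ b
      ∧-homo    : ∀ a b → f (a A.∧ b) B.≈ (f a B.∧ f b)
      top-homo  : f A.top B.≈ B.top
      ◇-homo    : ∀ R a → f (A.◇ R a) B.≈ B.◇ R (f a)

  Embeddable : SLO 𝓡 c₁ ℓ₁ → SLO 𝓡 c₂ ℓ₂ → Set (r ⊔ c₁ ⊔ ℓ₁ ⊔ c₂ ⊔ ℓ₂)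
  Embeddable 𝔄 𝔅 = ∃ (IsEmbedding 𝔄 𝔅)

-- Frames, and the SLOs in the consequence relations and in Complex, live in the
-- universe of the signature; subsets of W are predicates in that universe.

record Frame {ℓ} (𝓡 : Set ℓ) : Set (suc ℓ) where
  field
    W        : Set ℓ
    rel      : 𝓡 → Rel W ℓ
    nonempty : W

  step : Rel W ℓ
  step x y = ∃[ R ] rel R x y

module _ {ℓ} {𝓡 : Set ℓ} where

  module _ (𝔉 : Frame 𝓡) where
    open Frame 𝔉

    Truth : (ℕ → Pred W ℓ) → Formula 𝓡 → Pred W ℓ
    Truth 𝔳 (var p) w  = w ∈ 𝔳 p
    Truth 𝔳 ⊤̇ w        = ⊤
    Truth 𝔳 (φ ∧̇ ψ) w  = Truth 𝔳 φ w × Truth 𝔳 ψ w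
    Truth 𝔳 (◇̇ R φ) w  = ∃[ v ] rel R w v × Truth 𝔳 φ v

    _⊨ᶠ_ : Implication 𝓡 → Set (suc ℓ)
    _⊨ᶠ_ (σ ⟶ τ) = ∀ (𝔳 : ℕ → Pred W ℓ) (w : W) → Truth 𝔳 σ w → Truth 𝔳 τ w

    ValidatesᶠAll : Pred (Implication 𝓡) s → Set (suc ℓ ⊔ s)
    ValidatesᶠAll Σ = ∀ ι → ι ∈ Σ → _⊨ᶠ_ ι

    ◇⁺ : 𝓡 → Op₁ (Pred W ℓ)
    ◇⁺ R X w = ∃[ v ] v ∈ X × rel R w v

    _⋆ : SLO 𝓡 (suc ℓ) ℓ
    _⋆ = record
      { boundedMeetSemilattice = record
        { Carrier                  = Pred W ℓ
        ; _≈_                      = _≐_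
        ; _∧_                      = _∩_
        ; ⊤                        = U
        ; isBoundedMeetSemilattice = ∩-isIdempotentCommutativeMonoid W ℓ
        }
      ; ◇      = ◇⁺
      ; ◇-mono = λ R X≤Y →
          (λ p → proj₁ p) ,
          (λ { (v , v∈X , Rwv) → (v , v∈X , Rwv) , (v , proj₂ (proj₂ X≤Y v∈X) , Rwv) })
      }

  _⊨Kr_ : Pred (Implication 𝓡) s → Implication 𝓡 → Set (suc ℓ ⊔ s)
  Σ ⊨Kr ι = ∀ (𝔉 : Frame 𝓡) → ValidatesᶠAll 𝔉 Σ → 𝔉 ⊨ᶠ ι

  _⊨SLO_ : Pred (Implication 𝓡) s → Implication 𝓡 → Set (suc ℓ ⊔ s)
  Σ ⊨SLO ι = ∀ (𝔄 : SLO 𝓡 ℓ ℓ) → ValidatesᴬAll 𝔄 Σ → 𝔄 ⊨ᴬ ι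

  SPi+_ : Pred (Implication 𝓡) s → Pred (Implication 𝓡) (suc ℓ ⊔ s)
  SPi+ Σ = λ ι → Σ ⊨SLO ι

  -- Completeness of the logic SPi+ Σ, in terms of its axioms Σ.
  Complete : Pred (Implication 𝓡) s → Set (suc ℓ ⊔ s)
  Complete Σ = ∀ ι → Σ ⊨Kr ι ⇔ Σ ⊨SLO ι

  Complex : Pred (Implication 𝓡) s → Set (suc ℓ ⊔ s)
  Complex L = ∀ (𝔄 : SLO 𝓡 ℓ ℓ) → ValidatesᴬAll 𝔄 L →
              ∃[ 𝔉 ] ValidatesᶠAll 𝔉 L × Embeddable 𝔄 (𝔉 ⋆)

Finite : Set ℓ → Set ℓ
Finite A = ∃[ n ] (A ↔ Fin n)

IsRoot : {A : Set ℓ} → Rel A ℓ → A → Set ℓ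
IsRoot E r = ∀ x → Star E r x

record IsDirectedTree {A : Set ℓ} (E : Rel A ℓ) (r : A) : Set ℓ where
  field
    isRoot       : IsRoot E r
    root-no-pred : ∀ x → ¬ E x r
    pred-unique  : ∀ {x y z} → E x z → E y z → x ≡ y

record Profile {ℓ} (𝓡 : Set ℓ) : Set (suc ℓ) where
  field
    𝔊 : Frame 𝓡

  open Frame 𝔊 public renaming (W to Δ)

  field
    finite : Finite Δ
    rooted : ∃[ r ] IsRoot step r
    S      : 𝓡
    u v    : Δ
    uv∉S   : ¬ rel S u v

module _ {ℓ} {𝓡 : Set ℓ} where

  -- 𝔉 ⊨Φ π says that 𝔉 satisfies the first-order sentence Φ_π: the points of Δ
  -- are its variables, and h ranges over their assignments.
  _⊨Φ_ : Frame 𝓡 → Profile 𝓡 → Set ℓ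
  𝔉 ⊨Φ π = ∀ (h : Δ → F.W) →
           (∀ R x y → rel R x y → F.rel R (h x) (h y)) →
           F.rel S (h u) (h v)
    where
    open Profile π
    module F = Frame 𝔉

  HornWithProfile : Implication 𝓡 → Profile 𝓡 → Set (suc ℓ)
  HornWithProfile ι π = ∀ (𝔉 : Frame 𝓡) → (𝔉 ⊨ᶠ ι) ⇔ (𝔉 ⊨Φ π)

  record IsTreeProfile (π : Profile 𝓡) : Set ℓ where
    open Profile π
    field
      root     : Δ
      isTree   : IsDirectedTree step root
      disjoint : ∀ {R R′} → R ≢ R′ → ∀ x y → ¬ (rel R x y × rel R′ x y)

  record IsRootedTreeProfile (π : Profile 𝓡) : Set ℓ where
    open Profile π
    field
      isTreeProfile : IsTreeProfile π
      u≡root        : u ≡ IsTreeProfile.root isTreeProfile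

  record IsLeapfrogProfile (π : Profile 𝓡) : Set ℓ where
    open Profile π
    field
      isRootedTreeProfile : IsRootedTreeProfile π
      no-S-successor      : ¬ (∃[ w ] rel S u w)

  record IsLeapfrogImplication (ι : Implication 𝓡) : Set (suc ℓ) where
    field
      ϱ        : Formula 𝓡
      p        : ℕ
      π        : Profile 𝓡
      form     : ι ≡ (ϱ ⟶ ◇̇ (Profile.S π) (var p))
      horn     : HornWithProfile ι π
      leapfrog : IsLeapfrogProfile π

{-# OPTIONS --safe #-}
module Submission where

-- An SLO 𝔄 embeds into 𝔉⋆ via a ↦ {b ∣ b ≤ a}, where 𝔉 has the elements of 𝔄
-- as points and R(a, b) iff a ≤ ◇_R b.  It remains to see that 𝔉 satisfies Φ_π
-- for each axiom ϱ ⟶ ◇_S p of Σ, with leapfrog profile π = (𝔊, S, u, v).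
--
-- Let 𝔊[T] be 𝔊 with new edges S(u, y) for all y ∈ T.  The depth of a point in
-- the tree shows that a homomorphism 𝔊 → 𝔊[T] sends u to u, so 𝔊[Δ] satisfies
-- Φ_π and hence the axiom.  Thus the axiom can fail in 𝔊[T] only at u.  As it
-- does fail in 𝔊, where u has no S-successor, ϱ does not entail an S-successor.
--
-- Let h be a homomorphism from 𝔊 to 𝔉, let Q be the claim h u ≤ ◇_S (h v), and
-- T = {y ∣ y ≠ v or Q}.  If ϱ is true at u in 𝔊[T], then either p is true at
-- some y ≠ v, or the tree of ϱ is mapped to 𝔊 with all occurrences of p at v;
-- then h u ≤ ϱ[p ↦ h v] ≤ ◇_S (h v), which is Q.  So 𝔊[T] validates the axiom
-- and satisfies Φ_π, which gives v ∈ T and hence Q.  Having Q as a parameter of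
-- the frame, rather than refuting ¬ Q, keeps the argument constructive.

open import Defs
open import Algebra.Structures using (IsIdempotentCommutativeMonoid)
open import Data.Empty using (⊥-elim)
open import Data.Fin.Properties using (inj⇒≟)
open import Data.List.Base using (allFin)
open import Data.List.Extrema.Nat using (argmax; f[xs]≤f[argmax])
open import Data.List.Membership.Propositional.Properties using (∈-allFin)
open import Data.List.Relation.Unary.All using (lookup)
open import Data.Nat.Base as ℕ using (ℕ; zero; suc; _+_; _<_; z≤n; s≤s)
open import Data.Nat.Properties using (_≟_; m<m+n; <⇒≱)
open import Data.Product.Base using (∃-syntax; _×_; _,_; proj₁; proj₂)
open import Data.Sum.Base using (_⊎_; inj₁; inj₂)
open import Data.Unit.Polymorphic using (tt)
open import Function.Base using (_∘_; id)
open import Function.Bundles using (Equivalence; Inverse; mk⇔)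
open import Function.Properties.Inverse using (↔⇒↣)
open import Level using (Level)
open import Relation.Binary.Construct.Closure.ReflexiveTransitive using (Star; ε; _◅_)
import Relation.Binary.Construct.NaturalOrder.Left as NaturalOrder
import Relation.Binary.Construct.On as On
open import Relation.Binary.Core using (Rel)
open import Relation.Binary.Definitions using (DecidableEquality)
open import Relation.Binary.PropositionalEquality using (_≡_; _≢_; refl; sym; cong; cong₂; subst)
open import Relation.Nullary using (¬_; yes; no)
open import Relation.Unary using (Pred; _∈_; _∩_; _≐_)
open import Relation.Unary.Algebra using (∩-isIdempotentCommutativeMonoid)
open import Relation.Unary.Polymorphic using (U)

private
  variable
    c ℓ r s : Level

-- Order laws in a SLO.

module SLOProperties {𝓡 : Set r} (𝔄 : SLO 𝓡 c ℓ) where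
  open SLO 𝔄 hiding (refl; sym; trans)
  private
    module A = SLO 𝔄
    module N = NaturalOrder A._≈_ A._∧_

  ≤-refl : ∀ {a} → a ≤ a
  ≤-refl = idem _

  ≤-trans : ∀ {a b d} → a ≤ b → b ≤ d → a ≤ d
  ≤-trans p q = A.sym (N.trans isSemigroup (A.sym p) (A.sym q))

  ≤-antisym : ∀ {a b} → a ≤ b → b ≤ a → a ≈ b
  ≤-antisym p q = N.antisym isEquivalence comm (A.sym p) (A.sym q)

  ≤-reflexive-≈ : ∀ {a b} → a ≈ b → a ≤ b
  ≤-reflexive-≈ p = A.sym (N.reflexive isMagma idem p)

  ≤-top : ∀ {a} → a ≤ top
  ≤-top = identityʳ _

  ∧-lowerˡ : ∀ a b → a ∧ b ≤ a
  ∧-lowerˡ a b = A.sym (N.x∙y≤x isMeetSemilattice a b)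

  ∧-lowerʳ : ∀ a b → a ∧ b ≤ b
  ∧-lowerʳ a b = A.sym (N.x∙y≤y isMeetSemilattice a b)

  ∧-greatest : ∀ {a b d} → d ≤ a → d ≤ b → d ≤ a ∧ b
  ∧-greatest p q = A.sym (N.∙-presʳ-≤ isMeetSemilattice _ (A.sym p) (A.sym q))

-- Representation by down-sets and transfer of validity.

module _ {𝓡 : Set ℓ} (𝔄 : SLO 𝓡 ℓ ℓ) where
  open SLO 𝔄 using (Carrier; top; _≤_; ◇; ◇-mono)
  open SLOProperties 𝔄
  private module A = SLO 𝔄

  elementFrame : Frame 𝓡
  elementFrame = record
    { W        = Carrier
    ; rel      = λ R a b → a ≤ ◇ R b
    ; nonempty = top
    }

  -- In `◇-homo`, the greatest element `a` of its down-set is itself the successor required; the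
  -- converse is monotonicity.
  embeddable-elementFrame : Embeddable 𝔄 (elementFrame ⋆)
  embeddable-elementFrame = (λ a b → b ≤ a) , record
    { cong      = λ p → (λ q → ≤-trans q (≤-reflexive-≈ p)) ,
                        (λ q → ≤-trans q (≤-reflexive-≈ (A.sym p)))
    ; injective = λ p → ≤-antisym (proj₁ p ≤-refl) (proj₂ p ≤-refl)
    ; ∧-homo    = λ a b → (λ q → ≤-trans q (∧-lowerˡ a b) , ≤-trans q (∧-lowerʳ a b)) ,
                          (λ { (p , q) → ∧-greatest p q })
    ; top-homo  = (λ _ → tt) , (λ _ → ≤-top)
    ; ◇-homo    = λ R a → (λ q → a , ≤-refl , q) ,
                          (λ { (b , b≤a , q) → ≤-trans q (◇-mono R b≤a) })
    }

module _ {𝓡 : Set ℓ} {𝔄 : SLO 𝓡 ℓ ℓ} {𝔉 : Frame 𝓡} {f : SLO.Carrier 𝔄 → Pred (Frame.W 𝔉) ℓ}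
         (emb : IsEmbedding 𝔄 (𝔉 ⋆) f) where
  open SLO 𝔄 using (Carrier)
  open IsEmbedding emb

  embedding-value : ∀ (𝔞 : ℕ → Carrier) φ → f (value 𝔄 𝔞 φ) ≐ Truth 𝔉 (f ∘ 𝔞) φ
  embedding-value 𝔞 (var q) = id , id
  embedding-value 𝔞 ⊤̇       = top-homo
  embedding-value 𝔞 (φ ∧̇ ψ) =
    (λ x → let y , z = proj₁ (∧-homo _ _) x in
           proj₁ (embedding-value 𝔞 φ) y , proj₁ (embedding-value 𝔞 ψ) z) ,
    (λ { (y , z) → proj₂ (∧-homo _ _)
           (proj₂ (embedding-value 𝔞 φ) y , proj₂ (embedding-value 𝔞 ψ) z) })
  embedding-value 𝔞 (◇̇ R φ) =
    (λ x → let w , y , e = proj₁ (◇-homo R _) x in w , e , proj₁ (embedding-value 𝔞 φ) y) ,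
    (λ { (w , e , y) → proj₂ (◇-homo R _) (w , proj₂ (embedding-value 𝔞 φ) y , e) })

  embedding-reflects-validity : ∀ ι → 𝔉 ⊨ᶠ ι → 𝔄 ⊨ᴬ ι
  embedding-reflects-validity (σ ⟶ τ) valid 𝔞 = injective
    ( (λ x → proj₁ (proj₁ (∧-homo _ _) x))
    , (λ x → proj₂ (∧-homo _ _)
        (x , proj₂ (embedding-value 𝔞 τ) (valid (f ∘ 𝔞) _ (proj₁ (embedding-value 𝔞 σ) x)))))

-- Kripke soundness, and completeness from complexity.

module _ {𝓡 : Set ℓ} (𝔉 : Frame 𝓡) where

  -- The subalgebra of 𝔉⋆ generated by 𝔳, with formulas naming its elements:
  -- unlike 𝔉⋆, its carrier lives in the universe of the signature.
  generatedSLO : (ℕ → Pred (Frame.W 𝔉) ℓ) → SLO 𝓡 ℓ ℓ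
  generatedSLO 𝔳 = record
    { boundedMeetSemilattice = record
      { Carrier = Formula 𝓡
      ; _≈_     = λ φ ψ → T φ ≐ T ψ
      ; _∧_     = _∧̇_
      ; ⊤       = ⊤̇
      ; isBoundedMeetSemilattice = record
        { isCommutativeMonoid = record
          { isMonoid = record
            { isSemigroup = record
              { isMagma = record
                { isEquivalence = On.isEquivalence T M.isEquivalence
                ; ∙-cong        = M.∙-cong
                }
              ; assoc = λ φ ψ χ → M.assoc (T φ) (T ψ) (T χ)
              }
            ; identity = (λ φ → M.identityˡ (T φ)) , (λ φ → M.identityʳ (T φ))
            }
          ; comm = λ φ ψ → M.comm (T φ) (T ψ)
          }
        ; idem = λ φ → M.idem (T φ)
        }
      }
    ; ◇      = ◇̇
    ; ◇-mono = λ R φ≤ψ → proj₁ , (λ { (w , e , x) → (w , e , x) , (w , e , proj₂ (proj₂ φ≤ψ x)) })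
    }
    where
    T = Truth 𝔉 𝔳
    module M = IsIdempotentCommutativeMonoid
                 (∩-isIdempotentCommutativeMonoid (Frame.W 𝔉) ℓ)

  -- Valuations in `generatedSLO 𝔳` are substitutions, so this is the substitution lemma.
  Truth-value : ∀ 𝔳 𝔞 φ → Truth 𝔉 𝔳 (value (generatedSLO 𝔳) 𝔞 φ) ≡ Truth 𝔉 (Truth 𝔉 𝔳 ∘ 𝔞) φ
  Truth-value 𝔳 𝔞 (var q) = refl
  Truth-value 𝔳 𝔞 ⊤̇       = refl
  Truth-value 𝔳 𝔞 (φ ∧̇ ψ) = cong₂ _∩_ (Truth-value 𝔳 𝔞 φ) (Truth-value 𝔳 𝔞 ψ)
  Truth-value 𝔳 𝔞 (◇̇ R φ) =
    cong (λ P w → ∃[ x ] Frame.rel 𝔉 R w x × P x) (Truth-value 𝔳 𝔞 φ)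

  value-var : ∀ 𝔳 φ → value (generatedSLO 𝔳) var φ ≡ φ
  value-var 𝔳 (var q) = refl
  value-var 𝔳 ⊤̇       = refl
  value-var 𝔳 (φ ∧̇ ψ) = cong₂ _∧̇_ (value-var 𝔳 φ) (value-var 𝔳 ψ)
  value-var 𝔳 (◇̇ R φ) = cong (◇̇ R) (value-var 𝔳 φ)

  generatedSLO-validates : ∀ 𝔳 ι → 𝔉 ⊨ᶠ ι → generatedSLO 𝔳 ⊨ᴬ ι
  generatedSLO-validates 𝔳 (σ ⟶ τ) valid 𝔞 =
    proj₁ , λ {w} x → x , subst (w ∈_) (sym (Truth-value 𝔳 𝔞 τ))
                            (valid _ w (subst (w ∈_) (Truth-value 𝔳 𝔞 σ) x))

  -- Under the valuation `var` every formula denotes itself, so an inequality in `generatedSLO 𝔳` is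
  -- an inclusion of truth sets under `𝔳`.
  SPi+-sound : ∀ {Σ : Pred (Implication 𝓡) s} → ValidatesᶠAll 𝔉 Σ → ValidatesᶠAll 𝔉 (SPi+ Σ)
  SPi+-sound 𝔉⊨Σ (σ ⟶ τ) Σ⊨ι 𝔳 w x =
    subst (λ φ → Truth 𝔉 𝔳 φ w) (value-var 𝔳 τ)
      (proj₂ (proj₂ (Σ⊨ι (generatedSLO 𝔳) (λ ι ι∈Σ → generatedSLO-validates 𝔳 ι (𝔉⊨Σ ι ι∈Σ)) var)
        (subst (λ φ → Truth 𝔉 𝔳 φ w) (sym (value-var 𝔳 σ)) x)))

complex⇒complete : {𝓡 : Set ℓ} {Σ : Pred (Implication 𝓡) s} → Complex (SPi+ Σ) → Complete Σ
complex⇒complete {Σ = Σ} complex ι = mk⇔ to from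
  where
  to : Σ ⊨Kr ι → Σ ⊨SLO ι
  to Kr⊨ι 𝔄 𝔄⊨Σ with complex 𝔄 (λ κ Σ⊨κ → Σ⊨κ 𝔄 𝔄⊨Σ)
  ... | 𝔉 , 𝔉⊨SPi , f , emb =
    embedding-reflects-validity emb ι
      (Kr⊨ι 𝔉 (λ κ κ∈Σ → 𝔉⊨SPi κ (λ 𝔅 𝔅⊨Σ → 𝔅⊨Σ κ κ∈Σ)))

  from : Σ ⊨SLO ι → Σ ⊨Kr ι
  from Σ⊨ι 𝔉 𝔉⊨Σ = SPi+-sound 𝔉 𝔉⊨Σ ι Σ⊨ι

-- Depth in finite directed trees.

¬strictlyIncreasing : {A : Set ℓ} → Finite A → A → (f : A → ℕ) (g : A → A) →
                      ¬ (∀ x → f x < f (g x))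
¬strictlyIncreasing (n , A↔Fin) a f g f<f∘g =
  -- `g` cannot increase `f` at a maximum of `f`.
  <⇒≱ (f<f∘g (from m)) (subst (λ x → f x ℕ.≤ f (from m))
                          (strictlyInverseʳ (g (from m)))
                          (lookup (f[xs]≤f[argmax] {f = f ∘ from} (to a) (allFin n)) (∈-allFin (to (g (from m))))))
  where
  open Inverse A↔Fin
  m = argmax (f ∘ from) (to a) (allFin n)

module _ {A : Set ℓ} {E : Rel A ℓ} {ρ : A} (tree : IsDirectedTree E ρ) where
  open IsDirectedTree tree

  -- Built by adding edges at the far end, where `Star` adds them at the start; induction thus
  -- passes from a point to its children.
  data Depth : ℕ → A → Set ℓ where
    root  : Depth zero ρ
    child : ∀ {n x y} → Depth n x → E x y → Depth (suc n) y

  Depth-functional : ∀ {m n x} → Depth m x → Depth n x → m ≡ n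
  Depth-functional root        root         = refl
  Depth-functional root        (child _ e)  = ⊥-elim (root-no-pred _ e)
  Depth-functional (child _ e) root         = ⊥-elim (root-no-pred _ e)
  Depth-functional (child d e) (child d′ e′) with pred-unique e e′
  ... | refl = cong suc (Depth-functional d d′)

  Depth-zero : ∀ {x} → Depth zero x → x ≡ ρ
  Depth-zero root = refl

  depth : ∀ x → ∃[ n ] Depth n x
  depth x = along root (isRoot x)
    where
    along : ∀ {n y z} → Depth n y → Star E y z → ∃[ m ] Depth m z
    along d ε        = _ , d
    along d (e ◅ es) = along (child d e) es

-- Homomorphisms and added edges at the root.

module _ {𝓡 : Set ℓ} (𝔉 𝔉′ : Frame 𝓡) where
  private
    module F  = Frame 𝔉
    module F′ = Frame 𝔉′

  Truth-hom : (h : F.W → F′.W) → (∀ R x y → F.rel R x y → F′.rel R (h x) (h y)) →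
              ∀ 𝔳 φ x → Truth 𝔉 (λ q → 𝔳 q ∘ h) φ x → Truth 𝔉′ 𝔳 φ (h x)
  Truth-hom h hom 𝔳 (var q) x t           = t
  Truth-hom h hom 𝔳 ⊤̇       x t           = t
  Truth-hom h hom 𝔳 (φ ∧̇ ψ) x (t , t′)    = Truth-hom h hom 𝔳 φ x t , Truth-hom h hom 𝔳 ψ x t′
  Truth-hom h hom 𝔳 (◇̇ R φ) x (y , e , t) = h y , hom R x y e , Truth-hom h hom 𝔳 φ y t

module LeapfrogProfile {𝓡 : Set ℓ} (π : Profile 𝓡) (leapfrog : IsLeapfrogProfile π) where
  open Profile π
  open IsLeapfrogProfile leapfrog
  open IsRootedTreeProfile isRootedTreeProfile
  open IsTreeProfile isTreeProfile using () renaming (isTree to isTree′)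

  isTree : IsDirectedTree step u
  isTree = subst (IsDirectedTree step) (sym u≡root) isTree′

  open IsDirectedTree isTree using (root-no-pred)

  _≟Δ_ : DecidableEquality Δ
  _≟Δ_ = inj⇒≟ (↔⇒↣ (proj₂ finite))

  𝔊[_] : Pred Δ ℓ → Frame 𝓡
  𝔊[ T ] = record
    { W        = Δ
    ; rel      = λ R x y → rel R x y ⊎ (R ≡ S × x ≡ u × y ∈ T)
    ; nonempty = u
    }

  -- If `h u` had depth `suc m`, then `h` would raise every depth by `suc m`, which finiteness
  -- forbids.
  hom-fixes-root : ∀ T (h : Δ → Δ) → (∀ R x y → rel R x y → Frame.rel 𝔊[ T ] R (h x) (h y)) → h u ≡ u
  hom-fixes-root T h hom with depth isTree (h u)
  ... | zero  , d    = Depth-zero isTree d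
  ... | suc m , d    = ⊥-elim (¬strictlyIncreasing finite u (proj₁ ∘ depth isTree) h increasing)
    where
    shift : ∀ {n x} → Depth isTree n x → Depth isTree (n + suc m) (h x)
    shift root = d
    shift (child {n} d′ (R , e)) with hom R _ _ e
    ... | inj₁ e′             = child (shift d′) (R , e′)
    -- A new edge starts at `u`, of depth zero, but `h x` has positive depth.
    ... | inj₂ (_ , hx≡u , _) =
      ⊥-elim (0≢n+suc n (Depth-functional isTree root (subst (Depth isTree _) hx≡u (shift d′))))
      where
      0≢n+suc : ∀ n → 0 ≢ n + suc m
      0≢n+suc zero    ()
      0≢n+suc (suc _) ()

    increasing : ∀ x → proj₁ (depth isTree x) < proj₁ (depth isTree (h x))
    increasing x = subst (proj₁ (depth isTree x) <_)
      (Depth-functional isTree (shift (proj₂ (depth isTree x))) (proj₂ (depth isTree (h x))))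
      (m<m+n _ (s≤s z≤n))

  widen : ∀ {T} R x y → Frame.rel 𝔊[ T ] R x y → Frame.rel 𝔊[ U ] R x y
  widen R x y (inj₁ e)             = inj₁ e
  widen R x y (inj₂ (R≡S , q , _)) = inj₂ (R≡S , q , tt)

  𝔊[U]⊨Φ : 𝔊[ U ] ⊨Φ π
  𝔊[U]⊨Φ h hom = inj₂ (refl , hom-fixes-root U h hom , tt)

  module _ {ϱ : Formula 𝓡} {p : ℕ} (horn : HornWithProfile (ϱ ⟶ ◇̇ S (var p)) π) where

    fails-only-at-root : ∀ T 𝔳 w → Truth 𝔊[ T ] 𝔳 ϱ w →
                         ∃[ y ] y ∈ 𝔳 p × (rel S w y ⊎ w ≡ u)
    fails-only-at-root T 𝔳 w x
      with Equivalence.from (horn 𝔊[ U ]) 𝔊[U]⊨Φ 𝔳 w (Truth-hom 𝔊[ T ] 𝔊[ U ] id widen 𝔳 ϱ w x)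
    ... | y , inj₁ e           , y∈p = y , y∈p , inj₁ e
    ... | y , inj₂ (_ , q , _) , y∈p = y , y∈p , inj₂ q

    EntailsS : Pred (Formula 𝓡) _
    EntailsS φ = ∀ 𝔳 w → Truth 𝔊 𝔳 φ w → ∃[ y ] rel S w y

    -- Otherwise `ϱ` is never true at `u` in `𝔊`, so `𝔊` validates the axiom; the identity
    -- assignment then contradicts `uv∉S`.
    ¬EntailsS : ¬ EntailsS ϱ
    ¬EntailsS entails = uv∉S (Equivalence.to (horn 𝔊) 𝔊⊨ι id (λ _ _ _ e → e))
      where
      𝔊⊨ι : 𝔊 ⊨ᶠ (ϱ ⟶ ◇̇ S (var p))
      𝔊⊨ι 𝔳 w x with fails-only-at-root U 𝔳 w 
          (Truth-hom 𝔊 𝔊[ U ] id (λ _ _ _ → inj₁) 𝔳 ϱ w x)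
      ... | y , y∈p , inj₁ e    = y , e , y∈p
      ... | y , y∈p , inj₂ refl = ⊥-elim (no-S-successor (entails 𝔳 w x))

    -- The element frame satisfies the profile's sentence.

    module _ (𝔄 : SLO 𝓡 ℓ ℓ) (𝔄⊨ι : 𝔄 ⊨ᴬ (ϱ ⟶ ◇̇ S (var p)))
             (h : Δ → SLO.Carrier 𝔄)
             (hom : ∀ R x y → rel R x y → Frame.rel (elementFrame 𝔄) R (h x) (h y)) where
      open SLO 𝔄 using (Carrier; top; _≤_; ◇; ◇-mono)
      open SLOProperties 𝔄

      T : Pred Δ ℓ
      T y = y ≢ v ⊎ (h u ≤ ◇ S (h v))

      𝔞 : ℕ → Carrier
      𝔞 q with q ≟ p
      ... | yes _ = h v
      ... | no _  = top

      𝔞p≤hv : 𝔞 p ≤ h v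
      𝔞p≤hv with p ≟ p
      ... | yes _   = ≤-refl
      ... | no p≢p = ⊥-elim (p≢p refl)

      -- The cases: `p` is used away from `v`; a new edge is used, which happens only at `u`; or all
      -- edges used are old, and `h` carries them to inequalities in `𝔄`.
      trace : ∀ 𝔳 φ x → Truth 𝔊[ T ] 𝔳 φ x →
              (∃[ y ] y ∈ 𝔳 p × y ≢ v) ⊎ (x ≡ u × EntailsS φ) ⊎ (h x ≤ value 𝔄 𝔞 φ)
      trace 𝔳 (var q) x t with q ≟ p | x ≟Δ v
      ... | no _     | _        = inj₂ (inj₂ ≤-top)
      ... | yes refl | yes refl = inj₂ (inj₂ ≤-refl)
      ... | yes refl | no x≢v   = inj₁ (x , t , x≢v)
      trace 𝔳 ⊤̇ x t = inj₂ (inj₂ ≤-top)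
      trace 𝔳 (φ ∧̇ ψ) x (t , t′) with trace 𝔳 φ x t | trace 𝔳 ψ x t′
      ... | inj₁ y                | _                     = inj₁ y
      ... | inj₂ (inj₁ (x≡u , e)) | _                     = inj₂ (inj₁ (x≡u , λ 𝔴 w → e 𝔴 w ∘ proj₁))
      ... | inj₂ (inj₂ _)         | inj₁ y                = inj₁ y
      ... | inj₂ (inj₂ _)         | inj₂ (inj₁ (x≡u , e)) = inj₂ (inj₁ (x≡u , λ 𝔴 w → e 𝔴 w ∘ proj₂))
      ... | inj₂ (inj₂ l)         | inj₂ (inj₂ l′)        = inj₂ (inj₂ (∧-greatest l l′))
      trace 𝔳 (◇̇ R φ) x (y , inj₂ (refl , x≡u , _) , t) =
        inj₂ (inj₁ (x≡u , λ { 𝔴 w (z , e , _) → z , e }))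
      trace 𝔳 (◇̇ R φ) x (y , inj₁ e , t) with trace 𝔳 φ y t
      ... | inj₁ z                 = inj₁ z
      -- No old edge enters `u`, so a new edge is never reached through an old one.
      ... | inj₂ (inj₁ (refl , _)) = ⊥-elim (root-no-pred x (R , e))
      ... | inj₂ (inj₂ l)          = inj₂ (inj₂ (≤-trans (hom R x y e) (◇-mono R l)))

      𝔊[T]⊨ι : 𝔊[ T ] ⊨ᶠ (ϱ ⟶ ◇̇ S (var p))
      𝔊[T]⊨ι 𝔳 w t with fails-only-at-root T 𝔳 w t
      ... | y , y∈p , inj₁ e    = y , inj₁ e , y∈p
      ... | y , y∈p , inj₂ refl with trace 𝔳 ϱ u t
      ...   | inj₁ (z , z∈p , z≢v)   = z , inj₂ (refl , refl , inj₁ z≢v) , z∈p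
      ...   | inj₂ (inj₁ (_ , e))    = ⊥-elim (¬EntailsS e)
      ...   | inj₂ (inj₂ hu≤ϱ)       =
        -- Once `h u ≤ ◇ S (h v)` holds, `T` is all of `Δ`, so the given `y` serves.
        y , inj₂ (refl , refl , inj₂ (≤-trans hu≤ϱ (≤-trans (𝔄⊨ι 𝔞) (◇-mono S 𝔞p≤hv)))) , y∈p

      elementFrame-closed : h u ≤ ◇ S (h v)
      -- The identity assignment yields an `S`-edge from `u` to `v` in `𝔊[ T ]`; it must be new, so
      -- `v ∈ T`.
      elementFrame-closed with Equivalence.to (horn 𝔊[ T ]) 𝔊[T]⊨ι id (λ _ _ _ → inj₁)
      ... | inj₁ e                     = ⊥-elim (uv∉S e)
      ... | inj₂ (_ , _ , inj₁ v≢v)    = ⊥-elim (v≢v refl)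
      ... | inj₂ (_ , _ , inj₂ hu≤◇hv) = hu≤◇hv

-- Complexity and completeness for leapfrog axioms.

elementFrame-validates : {𝓡 : Set ℓ} (𝔄 : SLO 𝓡 ℓ ℓ) → ∀ ι → IsLeapfrogImplication ι →
                         𝔄 ⊨ᴬ ι → elementFrame 𝔄 ⊨ᶠ ι
elementFrame-validates 𝔄 ι record { ϱ = ϱ ; p = p ; π = π ; form = refl ; horn = horn ; leapfrog = leapfrog } 𝔄⊨ι =
  Equivalence.from (horn (elementFrame 𝔄)) (elementFrame-closed {ϱ} {p} horn 𝔄 𝔄⊨ι)
  where open LeapfrogProfile π leapfrog

theorem5p9 : ∀ {ℓ s} (𝓡 : Set ℓ) (R₀ : 𝓡) (Σ : Pred (Implication 𝓡) s) →
    (∀ ι → ι ∈ Σ → IsLeapfrogImplication ι) →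
    Complex (SPi+ Σ) × Complete Σ
theorem5p9 𝓡 R₀ Σ leapfrog = complex , complex⇒complete complex
  where
  complex : Complex (SPi+ Σ)
  complex 𝔄 𝔄⊨SPi =
    elementFrame 𝔄 ,
    SPi+-sound (elementFrame 𝔄)
      (λ ι ι∈Σ → elementFrame-validates 𝔄 ι (leapfrog ι ι∈Σ)
                   (𝔄⊨SPi ι (λ 𝔅 𝔅⊨Σ → 𝔅⊨Σ ι ι∈Σ))) ,
    embeddable-elementFrame 𝔄
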